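{- Let $K$ be a field of characteristic $0$ and let $S$ be a finite set of non-zero integers. Then there exists a positive integer $N$ such that $X_N^S=K^S$.
   Context: $K^S$ denotes the $K$-algebra of all functions $S\to K$ (with pointwise operations). Define $\gamma^S\colon K^*\to K^S$ by $\gamma^S(x)(s):=x^s$ for $s\in S$. For a positive integer $k$, let $X_k^S:=\{\sum_{i=1}^k\gamma^S(x_i)-\sum_{j=1}^k\gamma^S(y_j) : x_1,\dots,x_k,y_1,\dots,y_k\in K^*\}\subseteq K^S$. -}

module Defs where

open import Algebra.Apartness.Bundles using (HeytingCommutativeRing; HeytingField)
open import Algebra.Bundles using (CommutativeRing; Semiring)
import Algebra.Construct.Pointwise as Pointwise
import Algebra.Definitions.RawSemiring as RawSemiringDefinitions
open import Data.Fin.Base using (Fin)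
open import Data.Integer.Base using (ℤ; +_; -[1+_])
open import Data.List.Base using (List)
open import Data.List.Membership.Propositional using (_∈_)
open import Data.Nat.Base using (ℕ; suc; NonZero)
open import Data.Product.Base using (Σ; ∃₂; _,_; proj₁)
open import Level using (Level; _⊔_)
open import Relation.Unary using (Pred)

-- Constructively, a field is taken to be a Heyting field: x # y means that
-- x - y is invertible, and # is a tight apartness.  Classically x # y is the
-- same as ¬ (x ≈ y), so these are exactly the fields (1 # 0 is derivable).

module _ {c ℓ₁ ℓ₂ : Level} (K : HeytingField c ℓ₁ ℓ₂) where

  open HeytingField K

  K-ring : CommutativeRing c ℓ₁
  K-ring = HeytingCommutativeRing.commutativeRing heytingCommutativeRing

  open RawSemiringDefinitions
    (Semiring.rawSemiring (CommutativeRing.semiring K-ring))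
    using (_×_; _^_)

  -- "Non-zero" is read as # 0#, that is, as invertible.
  CharacteristicZero : Set ℓ₂
  CharacteristicZero = (n : ℕ) → .{{NonZero n}} → (n × 1#) # 0#

  K* : Set (c ⊔ ℓ₂)
  K* = Σ Carrier λ x → x # 0#

  -- #⇒invertible provides an inverse of x - 0#, which is ≈ to x.
  infix 9 _⁻¹
  _⁻¹ : K* → Carrier
  (_ , x#0) ⁻¹ = proj₁ (#⇒invertible x#0)

  infixr 8 _^ℤ_
  _^ℤ_ : K* → ℤ → Carrier
  x ^ℤ (+ n)    = proj₁ x ^ n
  x ^ℤ -[1+ n ] = x ⁻¹ ^ suc n

  -- The finite set S is a list, assumed duplicate-free where it is used.
  -- Membership proofs s ∈ S are then unique, so that a function on
  -- Σ ℤ (_∈ S) is the same as a function on the set S.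
  module _ (S : List ℤ) where

    Elements : Set
    Elements = Σ ℤ (_∈ S)

    K^ : CommutativeRing c ℓ₁
    K^ = Pointwise.commutativeRing Elements K-ring

    open CommutativeRing K^ using () renaming
      (Carrier to Functions; _≈_ to _≋_; _-_ to _⊖_)

    open RawSemiringDefinitions
      (Semiring.rawSemiring (CommutativeRing.semiring K^))
      using () renaming (sum to ∑)

    γ : K* → Functions
    γ x (s , _) = x ^ℤ s

    X : ℕ → Pred Functions (c ⊔ ℓ₁ ⊔ ℓ₂)
    X k f = ∃₂ λ (x y : Fin k → K*) →
      f ≋ (∑ (λ i → γ (x i)) ⊖ ∑ (λ j → γ (y j)))

{-# OPTIONS --safe #-}
module Submission where

open import Defs
open import Algebra.Apartness.Bundles using (HeytingField)
open import Data.Integer.Base using (ℤ; 0ℤ)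
open import Data.List.Base using (List)
open import Data.List.Relation.Unary.All using (All)
open import Data.List.Relation.Unary.Unique.Propositional using (Unique)
open import Data.Nat.Base using (ℕ; _>_)
open import Data.Product.Base using (∃; _×_)
open import Relation.Binary.PropositionalEquality.Core using (_≢_)
open import Relation.Unary using (_≐_; U)

open import Algebra.Bundles using (CommutativeRing)
import Algebra.Apartness.Properties.HeytingCommutativeRing as HeytingProperties
import Algebra.Properties.CommutativeSemiring.Exp as Exp
import Algebra.Properties.Ring as RingProperties
import Algebra.Properties.Semiring.Mult as Mult
import Algebra.Properties.Semiring.Sum as Sum
import Algebra.Solver.Ring.NaturalCoefficients.Default as Solver
open import Data.Fin.Base as Fin using (Fin; toℕ; inject₁)
import Data.Fin.Properties as Fin
open import Data.Integer.Base using (+_; -[1+_])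
import Data.Integer.Properties as ℤ
open import Data.List.Base using ([]; _∷_)
import Data.List.Membership.DecPropositional as DecMembership
open import Data.List.Membership.Propositional using (_∈_)
open import Data.List.Membership.Propositional.Properties.WithK using (unique⇒irrelevant)
import Data.List.Relation.Unary.All as All
open import Data.List.Relation.Unary.Any using (here; there)
open import Data.Nat.Base as ℕ using (zero; suc; _<_; s≤s; z≤n)
import Data.Nat.Properties as ℕ
open import Data.Product.Base using (∃₂; _,_; proj₁; proj₂)
open import Data.Sum.Base using (_⊎_; inj₁; inj₂; swap)
import Data.Sum.Effectful.Left as Left
open import Data.Vec.Functional using () renaming (_∷_ to _∷ᶠ_)
open import Function.Base using (_∘_)
open import Level using (Level; _⊔_)
open import Relation.Binary.Definitions using (tri<; tri≈; tri>)
open import Relation.Binary.PropositionalEquality.Core as ≡ using (_≡_)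
import Relation.Binary.Reasoning.Setoid as SetoidReasoning
open import Relation.Nullary using (yes; no; contradiction)

{-
Every X k is stable under multiplication by γ x, and sums and differences of
elements of X j and X k lie in X (j + k).  For t ∈ ℤ let β be 2 or 1/2 so that
N = β^t is a natural number: γ β - N vanishes at t only.  The product of these
functions over t = 0 and t ∈ S ∖ {s} therefore gives some E in some X k that is
supported at s, and then so is every x^s E.  Taking iterated differences of
y ↦ y^|s| until it becomes affine shows that boundedly many signed |s|-th powers
of invertible elements add up to any prescribed value, so all multiples of the
indicator function of s lie in a common X k.  Adding these up over s ∈ S gives
all functions.
-}

-- Signed sums of values of a multiplicative map

module SignedSums {g c ℓ} (F : CommutativeRing c ℓ) {G : Set g} (_·_ : G → G → G)
  (γ′ : G → CommutativeRing.Carrier F)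
  (γ′-· : ∀ x y → CommutativeRing._≈_ F (γ′ (x · y)) (CommutativeRing._*_ F (γ′ x) (γ′ y)))
  where

  open CommutativeRing F
  open RingProperties ring
  open Sum semiring
  open Solver commutativeSemiring using (solve; _:+_; _:=_)

  SignedSum : ℕ → Carrier → Set (g ⊔ ℓ)
  SignedSum k f = ∃₂ λ (x y : Fin k → G) →
    f ≈ sum (λ i → γ′ (x i)) - sum (λ i → γ′ (y i))

  SignedSum-resp : ∀ {k f h} → f ≈ h → SignedSum k f → SignedSum k h
  SignedSum-resp f≈h (x , y , f≈) = x , y , trans (sym f≈h) f≈

  SignedSum-zero : SignedSum 0 0#
  SignedSum-zero = (λ ()) , (λ ()) , sym (-‿inverseʳ 0#)

  SignedSum-γ-γ : ∀ x y → SignedSum 1 (γ′ x - γ′ y)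
  SignedSum-γ-γ x y = (λ _ → x) , (λ _ → y) ,
    sym (+-cong (+-identityʳ (γ′ x)) (-‿cong (+-identityʳ (γ′ y))))

  SignedSum-neg : ∀ {k f} → SignedSum k f → SignedSum k (- f)
  SignedSum-neg (x , y , f≈) = y , x ,
    trans (-‿cong f≈) (⁻¹-anti-homo‿- _ _)

  [a+b]-[c+d] : ∀ a b c d → (a + b) - (c + d) ≈ (a - c) + (b - d)
  [a+b]-[c+d] a b c d = trans (+-congˡ (sym (-‿+-comm c d)))
    (solve 4 (λ a b c d → (a :+ b) :+ (c :+ d) := (a :+ c) :+ (b :+ d))
      refl a b (- c) (- d))

  SignedSum-∷ : ∀ {k f} x y → SignedSum k f → SignedSum (suc k) ((γ′ x - γ′ y) + f)
  SignedSum-∷ x y (xs , ys , f≈) = x ∷ᶠ xs , y ∷ᶠ ys ,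
    trans (+-congˡ f≈) (sym ([a+b]-[c+d] (γ′ x) _ (γ′ y) _))

  -- Pairs are moved across one at a time by `SignedSum-∷`, so `Fin (j ℕ.+ k)` never has to be
  -- split.
  SignedSum-+ : ∀ {j k f h} → SignedSum j f → SignedSum k h → SignedSum (j ℕ.+ k) (f + h)
  SignedSum-+ {zero} {h = h} (_ , _ , f≈) h∈ = SignedSum-resp
    (sym (trans (+-congʳ (trans f≈ (-‿inverseʳ 0#))) (+-identityˡ h)))
    h∈
  SignedSum-+ {suc j} {h = h} (x , y , f≈) h∈ = SignedSum-resp
    (trans (sym (+-assoc _ _ h)) (+-congʳ (sym (trans f≈ ([a+b]-[c+d] _ _ _ _)))))
    (SignedSum-∷ (x Fin.zero) (y Fin.zero)
      (SignedSum-+ {j} (x ∘ Fin.suc , y ∘ Fin.suc , refl) h∈))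

  -- Multiplicativity absorbs `γ′ z` into each term. The length `k` does not depend on `z`, which is
  -- the source of the later uniform bounds.
  SignedSum-γ* : ∀ {k f} z → SignedSum k f → SignedSum k (γ′ z * f)
  SignedSum-γ* z (x , y , f≈) = (λ i → z · x i) , (λ i → z · y i) ,
    trans (*-congˡ f≈)
      (trans (x[y-z]≈xy-xz (γ′ z) _ _) (+-cong (γ*sum x) (-‿cong (γ*sum y))))
    where
    γ*sum : ∀ {n} (x : Fin n → G) →
      γ′ z * sum (λ i → γ′ (x i)) ≈ sum (λ i → γ′ (z · x i))
    γ*sum x = trans (*-distribˡ-sum (γ′ z) (λ i → γ′ (x i)))
      (sum-cong-≋ (λ i → sym (γ′-· z (x i))))

module _ {c ℓ₁ ℓ₂ : Level} (K : HeytingField c ℓ₁ ℓ₂) where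

  open CommutativeRing (K-ring K) renaming (zero to *-zero)
  open HeytingField K using
    (_#_; #-sym; #-cotrans; #⇒invertible; heytingCommutativeRing)
  open HeytingProperties heytingCommutativeRing
  open RingProperties ring
  open Mult semiring renaming (_×_ to _×′_)
  open Exp commutativeSemiring
  open Solver commutativeSemiring using (solve; _:+_; _:*_; _:=_; con)
  open SetoidReasoning setoid

  private
    infixr 8 _^ᶻ_
    _^ᶻ_ : K* K → ℤ → Carrier
    _^ᶻ_ = _^ℤ_ K

    inv : K* K → Carrier
    inv = _⁻¹ K

  x-y≈z : ∀ {x y z} → x ≈ z + y → x - y ≈ z
  x-y≈z {x} {y} {z} x≈z+y = begin
    x - y          ≈⟨ +-congʳ x≈z+y ⟩
    (z + y) - y    ≈⟨ +-assoc z y (- y) ⟩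
    z + (y - y)    ≈⟨ +-congˡ (-‿inverseʳ y) ⟩
    z + 0#         ≈⟨ +-identityʳ z ⟩
    z              ∎

  -- Apartness from zero

  inverse#0 : ∀ {x y} → x * y ≈ 1# → x # 0#
  inverse#0 {x} {y} xy≈1 =
    invertibleʳ⇒# (y , trans (*-congʳ (x-0≈x x)) xy≈1)

  inv-inverseʳ : (x : K* K) → proj₁ x * inv x ≈ 1#
  inv-inverseʳ (x , x#0) =
    trans (*-congʳ (sym (x-0≈x x))) (proj₂ (proj₂ (#⇒invertible x#0)))

  inv* : K* K → K* K
  inv* x = inv x , inverse#0 (trans (*-comm _ _) (inv-inverseʳ x))

  one* : K* K
  one* = 1# , 1#0

  infixl 7 _·_
  _·_ : K* K → K* K → K* K
  (x , x#0) · (y , y#0) = x * y , x#0y#0→xy#0 x#0 y#0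

  inverse-unique : ∀ {x y z} → x * y ≈ 1# → x * z ≈ 1# → y ≈ z
  inverse-unique {x} {y} {z} xy≈1 xz≈1 = begin
    y            ≈⟨ *-identityʳ y ⟨
    y * 1#       ≈⟨ *-congˡ xz≈1 ⟨
    y * (x * z)  ≈⟨ solve 3 (λ x y z → y :* (x :* z) := (x :* y) :* z) refl x y z ⟩
    (x * y) * z  ≈⟨ *-congʳ xy≈1 ⟩
    1# * z       ≈⟨ *-identityˡ z ⟩
    z            ∎

  inv-· : ∀ x y → inv (x · y) ≈ inv x * inv y
  inv-· x y = inverse-unique (inv-inverseʳ (x · y)) (begin
    (proj₁ x * proj₁ y) * (inv x * inv y)
      ≈⟨ solve 4 (λ a b c d → (a :* b) :* (c :* d) := (a :* c) :* (b :* d)) refl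
           (proj₁ x) (proj₁ y) (inv x) (inv y) ⟩
    (proj₁ x * inv x) * (proj₁ y * inv y)
      ≈⟨ *-cong (inv-inverseʳ x) (inv-inverseʳ y) ⟩
    1# * 1#
      ≈⟨ *-identityˡ 1# ⟩
    1# ∎)

  inv-inv* : ∀ x → inv (inv* x) ≈ proj₁ x
  inv-inv* x = inverse-unique (inv-inverseʳ (inv* x))
    (trans (*-comm _ _) (inv-inverseʳ x))

  inv-one* : inv one* ≈ 1#
  inv-one* = inverse-unique (inv-inverseʳ one*) (*-identityˡ 1#)

  1^n≈1 : ∀ n → 1# ^ n ≈ 1#
  1^n≈1 zero    = refl
  1^n≈1 (suc n) = trans (*-identityˡ _) (1^n≈1 n)

  ^ᶻ-distrib-· : ∀ x y s → (x · y) ^ᶻ s ≈ x ^ᶻ s * y ^ᶻ s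
  ^ᶻ-distrib-· x y (+ n)    = ^-distrib-* (proj₁ x) (proj₁ y) n
  ^ᶻ-distrib-· x y -[1+ n ] =
    trans (^-congˡ (suc n) (inv-· x y)) (^-distrib-* (inv x) (inv y) (suc n))

  one*^ᶻ : ∀ s → one* ^ᶻ s ≈ 1#
  one*^ᶻ (+ n)    = 1^n≈1 n
  one*^ᶻ -[1+ n ] = trans (^-congˡ (suc n) inv-one*) (1^n≈1 (suc n))

  x*y#0⇒y#0 : ∀ {x y} → (x * y) # 0# → y # 0#
  x*y#0⇒y#0 {x} {y} xy#0 = inverse#0 (begin
    y * (x * z)  ≈⟨ solve 3 (λ x y z → y :* (x :* z) := (x :* y) :* z) refl x y z ⟩
    (x * y) * z  ≈⟨ inv-inverseʳ (x * y , xy#0) ⟩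
    1#           ∎)
    where z = inv (x * y , xy#0)

  #⇒-#0 : ∀ {x y} → x # y → (x - y) # 0#
  #⇒-#0 x#y = inverse#0 (proj₂ (proj₂ (#⇒invertible x#y)))

  -#0⇒# : ∀ {x y} → (x - y) # 0# → x # y
  -#0⇒# x-y#0 = invertibleʳ⇒# (_ , inv-inverseʳ (_ , x-y#0))

  -- Functions of the exponent, restricted to a finite set

  module _ (S : List ℤ) where

    open SignedSums (K^ K S) _·_ (γ K S) (λ x y (s , _) → ^ᶻ-distrib-· x y s) public

    -- Functions on S are handled as restrictions of functions on ℤ; a record,
    -- unlike a synonym for X, lets h be inferred.
    record T (k : ℕ) (h : ℤ → Carrier) : Set (c ⊔ ℓ₁ ⊔ ℓ₂) where
      constructor restrict
      field restriction : X K S k (h ∘ proj₁)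

    open T public

    T-resp : ∀ {k f h} → (∀ {s} → s ∈ S → f s ≈ h s) → T k f → T k h
    T-resp f≈h (restrict f∈X) =
      restrict (SignedSum-resp (λ (_ , s∈S) → f≈h s∈S) f∈X)

    T-zero : T 0 (λ _ → 0#)
    T-zero = restrict SignedSum-zero

    T-γ-γ : ∀ x y → T 1 (λ s → x ^ᶻ s - y ^ᶻ s)
    T-γ-γ x y = restrict (SignedSum-γ-γ x y)

    T-+ : ∀ {j k f h} → T j f → T k h → T (j ℕ.+ k) (λ s → f s + h s)
    T-+ {j} {k} (restrict f∈X) (restrict h∈X) =
      restrict (SignedSum-+ {j} {k} f∈X h∈X)

    T-minus : ∀ {j k f h} → T j f → T k h → T (j ℕ.+ k) (λ s → f s - h s)
    T-minus {j} {k} (restrict f∈X) (restrict h∈X) =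
      restrict (SignedSum-+ {j} {k} f∈X (SignedSum-neg h∈X))

    T-γ* : ∀ {k f} x → T k f → T k (λ s → x ^ᶻ s * f s)
    T-γ* x (restrict f∈X) = restrict (SignedSum-γ* x f∈X)

    T-× : ∀ {k f} n → T k f → T (n ℕ.* k) (λ s → n ×′ f s)
    T-× zero    f∈T = T-zero
    T-× (suc n) f∈T = T-+ f∈T (T-× n f∈T)

    -- Adds γ 1 - γ 1. This secures a positive length, since for empty `S` the construction yields
    -- length 0.
    T-pad : ∀ {k h} → T k h → T (suc k) h
    T-pad {h = h} h∈T = T-resp
      (λ {s} _ → trans (+-congʳ (-‿inverseʳ (one* ^ᶻ s))) (+-identityˡ (h s)))
      (T-+ (T-γ-γ one* one*) h∈T)

    -- Interpolation by multiples of indicator functions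

    δ : ℤ → Carrier → ℤ → Carrier
    δ s a u with u ℤ.≟ s
    ... | yes _ = a
    ... | no  _ = 0#

    δ-unique : ∀ {s a} {h : ℤ → Carrier} → h s ≈ a →
               (∀ {u} → u ∈ S → u ≢ s → h u ≈ 0#) →
               ∀ {u} → u ∈ S → h u ≈ δ s a u
    δ-unique {s} hs≈a h≈0 {u} u∈S with u ℤ.≟ s
    ... | yes ≡.refl = hs≈a
    ... | no u≢s     = h≈0 u∈S u≢s

    δ-diag : ∀ s a → δ s a s ≈ a
    δ-diag s a with s ℤ.≟ s
    ... | yes _  = refl
    ... | no s≢s = contradiction ≡.refl s≢s

    δ-off : ∀ {s u} a → u ≢ s → δ s a u ≈ 0#
    δ-off {s} {u} a u≢s with u ℤ.≟ s
    ... | yes u≡s = contradiction u≡s u≢s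
    ... | no _    = refl

    -- The lengths for the single points add up to a `k` that is fixed before `h` is given.
    interpolate : ∀ {L} → All (λ s → ∃ λ k → ∀ a → T k (δ s a)) L →
      ∃ λ k → ∀ (h : ℤ → Carrier) → ∃ λ f → T k f × (∀ {s} → s ∈ L → f s ≈ h s)
    interpolate All.[] = 0 , λ h → (λ _ → 0#) , T-zero , λ ()
    interpolate {s ∷ L} ((j , δ∈T) All.∷ δs) with interpolate δs
    ... | k , interp = j ℕ.+ k , correct
      where
      correct : ∀ (h : ℤ → Carrier) → ∃ λ f → T (j ℕ.+ k) f × (∀ {u} → u ∈ s ∷ L → f u ≈ h u)
      correct h with interp h
      ... | f , f∈T , f≈h =
        -- The value of `f` at `s` is not controlled, so the new summand carries the defect
        -- `h s - f s`.
        (λ u → δ s (h s - f s) u + f u) , T-+ (δ∈T (h s - f s)) f∈T , agrees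
        where
        agrees-s : δ s (h s - f s) s + f s ≈ h s
        agrees-s = begin
          δ s (h s - f s) s + f s  ≈⟨ +-congʳ (δ-diag s _) ⟩
          (h s - f s) + f s        ≈⟨ +-assoc _ _ _ ⟩
          h s + (- f s + f s)      ≈⟨ +-congˡ (-‿inverseˡ (f s)) ⟩
          h s + 0#                 ≈⟨ +-identityʳ (h s) ⟩
          h s                      ∎

        agrees : ∀ {u} → u ∈ s ∷ L → δ s (h s - f s) u + f u ≈ h u
        agrees (here ≡.refl) = agrees-s
        -- `s` may occur again in `L`; the corrected value at `s` settles that case too.
        agrees {u} (there u∈L) with u ℤ.≟ s
        ... | yes ≡.refl = trans (+-congʳ (sym (δ-diag s _))) agrees-s
        ... | no _       = trans (+-identityˡ (f u)) (f≈h u∈L)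

    open DecMembership ℤ._≟_ using (_∈?_)

    extend : (Elements K S → Carrier) → ℤ → Carrier
    extend f s with s ∈? S
    ... | yes s∈S = f (s , s∈S)
    ... | no _    = 0#

    -- `f` may depend on the membership proof, and `∈?` may find a different one; `Unique S`
    -- identifies the two.
    extend-∈ : Unique S → ∀ f e → extend f (proj₁ e) ≡ f e
    extend-∈ S! f (s , s∈S) with s ∈? S
    ... | yes s∈S′ = ≡.cong (λ p → f (s , p)) (unique⇒irrelevant S! s∈S′ s∈S)
    ... | no s∉S   = contradiction s∈S s∉S

    T-extend⇒X : Unique S → ∀ {k f} → T k (extend f) → X K S k f
    T-extend⇒X S! {f = f} f∈T =
      SignedSum-resp (λ e → reflexive (extend-∈ S! f e)) (restriction f∈T)

  -- Powers of two in characteristic zero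

  module _ (char0 : CharacteristicZero K) where

    <⇒×1#×1 : ∀ {m n} → m < n → (n ×′ 1#) # (m ×′ 1#)
    <⇒×1#×1 {m} {n} m<n = -#0⇒# (#-congʳ (sym (x-y≈z (begin
      n ×′ 1#                        ≈⟨ ×-congˡ (≡.sym (ℕ.m∸n+n≡m (ℕ.<⇒≤ m<n))) ⟩
      (n ℕ.∸ m ℕ.+ m) ×′ 1#          ≈⟨ ×-homo-+ 1# (n ℕ.∸ m) m ⟩
      (n ℕ.∸ m) ×′ 1# + m ×′ 1#      ∎)))
      (char0 (n ℕ.∸ m) {{ℕ.>-nonZero (ℕ.m<n⇒0<n∸m m<n)}}))

    ≢⇒2^×1#2^×1 : ∀ {m n} → m ≢ n → ((2 ℕ.^ m) ×′ 1#) # ((2 ℕ.^ n) ×′ 1#)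
    ≢⇒2^×1#2^×1 {m} {n} m≢n with ℕ.<-cmp m n
    ... | tri< m<n _ _ = #-sym (<⇒×1#×1 (ℕ.^-monoʳ-< 2 (s≤s (s≤s z≤n)) m<n))
    ... | tri≈ _ m≡n _ = contradiction m≡n m≢n
    ... | tri> _ _ n<m = <⇒×1#×1 (ℕ.^-monoʳ-< 2 (s≤s (s≤s z≤n)) n<m)

    two* : K* K
    two* = 2 ×′ 1# , char0 2

    half* : K* K
    half* = inv* two*

    ×1-homo-^ : ∀ m n → (m ×′ 1#) ^ n ≈ (m ℕ.^ n) ×′ 1#
    ×1-homo-^ m zero    = sym (×-homo-1 1#)
    ×1-homo-^ m (suc n) =
      trans (*-congˡ (×1-homo-^ m n)) (sym (×1-homo-* m (m ℕ.^ n)))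

    -- Treats both bases at once: for β = 2 take β and its inverse as `a` and `b`, for β = 1/2 the
    -- inverse of β and β. In the second case `a` is 2 only up to `≈`.
    module _ {a b : Carrier} (a≈2 : a ≈ 2 ×′ 1#) (ab≈1 : a * b ≈ 1#) where

      a^n≈2^n : ∀ n → a ^ n ≈ (2 ℕ.^ n) ×′ 1#
      a^n≈2^n n = trans (^-congˡ n a≈2) (×1-homo-^ 2 n)

      a^m-2^n#0 : ∀ {m n} → m ≢ n → (a ^ m - (2 ℕ.^ n) ×′ 1#) # 0#
      a^m-2^n#0 {m} m≢n =
        #⇒-#0 (#-congʳ (sym (a^n≈2^n m)) (≢⇒2^×1#2^×1 m≢n))

      b^m-2^n#0 : ∀ {m n} → 0 < m ℕ.+ n → (b ^ m - (2 ℕ.^ n) ×′ 1#) # 0#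
      -- Multiplying by `a ^ m` clears the denominator and leaves 1 - 2^(m+n), where 1 is written as
      -- 2^0.
      b^m-2^n#0 {m} {n} 0<m+n = x*y#0⇒y#0 (#-congʳ (sym eq)
        (#⇒-#0 (≢⇒2^×1#2^×1 {0} (ℕ.<⇒≢ 0<m+n))))
        where
        p = (2 ℕ.^ m) ×′ 1#
        q = (2 ℕ.^ n) ×′ 1#
        eq : a ^ m * (b ^ m - q) ≈ 1 ×′ 1# - (2 ℕ.^ (m ℕ.+ n)) ×′ 1#
        eq = begin
          a ^ m * (b ^ m - q)
            ≈⟨ distribˡ (a ^ m) (b ^ m) (- q) ⟩
          a ^ m * b ^ m + a ^ m * - q
            ≈⟨ +-cong (sym (^-distrib-* a b m)) (sym (-‿distribʳ-* (a ^ m) q)) ⟩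
          (a * b) ^ m - a ^ m * q
            ≈⟨ +-cong (trans (^-congˡ m ab≈1) (1^n≈1 m))
                 (-‿cong (*-congʳ (a^n≈2^n m))) ⟩
          1# - p * q
            ≈⟨ +-cong (sym (×-homo-1 1#))
                 (-‿cong (sym (×1-homo-* (2 ℕ.^ m) (2 ℕ.^ n)))) ⟩
          1 ×′ 1# - (2 ℕ.^ m ℕ.* 2 ℕ.^ n) ×′ 1#
            ≈⟨ +-congˡ (-‿cong (×-congˡ (≡.sym (ℕ.^-distribˡ-+-* 2 m n)))) ⟩
          1 ×′ 1# - (2 ℕ.^ (m ℕ.+ n)) ×′ 1# ∎

    -- The base is 2 or 1/2, according to the sign of t, so that its t-th
    -- power is a natural number.
    separate : ∀ t → ∃₂ λ β N → (β ^ᶻ t ≈ N ×′ 1#) ×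
               (∀ s → s ≢ t → (β ^ᶻ s - N ×′ 1#) # 0#)
    separate (+ n) = two* , 2 ℕ.^ n , ×1-homo-^ 2 n , λ where
      (+ m) s≢t    → a^m-2^n#0 refl (inv-inverseʳ two*) (s≢t ∘ ≡.cong (+_))
      -[1+ m ] s≢t → b^m-2^n#0 refl (inv-inverseʳ two*) {suc m} {n} (s≤s z≤n)
    separate -[1+ n ] = half* , 2 ℕ.^ suc n ,
      trans (^-congˡ (suc n) (inv-inv* two*)) (×1-homo-^ 2 (suc n)) , λ where
      (+ m) s≢t    → b^m-2^n#0 (inv-inv* two*)
        (trans (*-comm _ _) (inv-inverseʳ half*)) {m}
        (ℕ.≤-trans (s≤s z≤n) (ℕ.m≤n+m (suc n) m))
      -[1+ m ] s≢t → a^m-2^n#0 (inv-inv* two*)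
        (trans (*-comm _ _) (inv-inverseʳ half*))
        (s≢t ∘ ≡.cong -[1+_] ∘ ℕ.suc-injective)

    -- Waring's problem

    -- Lead n a p stands for "p is a polynomial of degree at most suc n, and
    -- a is (suc n)! times its coefficient of x ^ suc n".  The difference q x = p (x + 1) - p x
    -- is written without subtraction, to leave only semiring identities.
    Lead : ℕ → Carrier → (Carrier → Carrier) → Set (c ⊔ ℓ₁)
    Lead zero    a p = ∀ x w → p (x + w) ≈ a * w + p x
    Lead (suc n) a p =
      ∃ λ q → (∀ x → p (x + 1#) ≈ q x + p x) × Lead n a q

    Lead-resp : ∀ n {a b p} → a ≈ b → Lead n a p → Lead n b p
    Lead-resp zero    a≈b p-lin x w = trans (p-lin x w) (+-congʳ (*-congʳ a≈b))
    Lead-resp (suc n) a≈b (q , Δp , q-lead) = q , Δp , Lead-resp n a≈b q-lead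

    Lead-+ : ∀ n {a b p q} → Lead n a p → Lead n b q →
             Lead n (a + b) (λ x → p x + q x)
    Lead-+ zero {a} {b} {p} {q} p-lin q-lin x w =
      trans (+-cong (p-lin x w) (q-lin x w))
        (solve 5 (λ a b w p q → (a :* w :+ p) :+ (b :* w :+ q)
                             := (a :+ b) :* w :+ (p :+ q))
          refl a b w (p x) (q x))
    Lead-+ (suc n) {p = p} {q} (p′ , Δp , p-lead) (q′ , Δq , q-lead) =
      (λ x → p′ x + q′ x) ,
      (λ x → trans (+-cong (Δp x) (Δq x))
        (solve 4 (λ a b c d → (a :+ b) :+ (c :+ d) := (a :+ c) :+ (b :+ d))
          refl (p′ x) (p x) (q′ x) (q x))) ,
      Lead-+ n p-lead q-lead

    -- Lets a polynomial of lower degree enter `Lead-+`, which wants equal degree bounds.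
    Lead-raise : ∀ n {a p} → Lead n a p → Lead (suc n) 0# p
    Lead-raise zero {a} p-lin =
      (λ _ → a) ,
      (λ x → trans (p-lin x 1#) (+-congʳ (*-identityʳ a))) ,
      (λ x w → sym (trans (+-congʳ (zeroˡ w)) (+-identityˡ a)))
    Lead-raise (suc n) (q , Δp , q-lead) = q , Δp , Lead-raise n q-lead

    -- Product rule for differences: Δ(x p) = x Δp + (Δp + p). The factor arises from (n+2)! = (n+2)
    -- (n+1)!.
    Lead-x* : ∀ n {a p} → Lead n a p →
              Lead (suc n) (suc (suc n) ×′ a) (λ x → x * p x)
    Lead-x* zero {a} {p} p-lin =
      (λ x → x * a + (a + p x)) ,
      (λ x → trans
        (*-congˡ (trans (p-lin x 1#) (+-congʳ (*-identityʳ a))))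
        (solve 3 (λ x a p → (x :+ con 1) :* (a :+ p)
                         := (x :* a :+ (a :+ p)) :+ x :* p)
          refl x a (p x))) ,
      (λ x w → trans (+-congˡ (+-congˡ (p-lin x w)))
        (solve 4 (λ x a w p → (x :+ w) :* a :+ (a :+ (a :* w :+ p))
                           := (a :+ (a :+ con 0)) :* w :+ (x :* a :+ (a :+ p)))
          refl x a w (p x)))
    Lead-x* (suc n) {a} {p} p-lead@(q , Δp , q-lead) =
      (λ x → x * q x + (q x + p x)) ,
      (λ x → trans (*-congˡ (Δp x))
        (solve 3 (λ x q p → (x :+ con 1) :* (q :+ p)
                         := (x :* q :+ (q :+ p)) :+ x :* p)
          refl x (q x) (p x))) ,
      -- `x * q x` contributes `suc (suc n) ×′ a` by induction, `q` contributes 0, and `p` one more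
      -- `a`.
      Lead-resp (suc n) {suc (suc n) ×′ a + (0# + a)}
        (trans (+-congˡ (+-identityˡ a)) (+-comm _ a))
        (Lead-+ (suc n) (Lead-x* n q-lead)
          (Lead-+ (suc n) (Lead-raise n q-lead) p-lead))

    -- The constant is `(suc n)!`, apart from zero because the characteristic is 0.
    Lead-^ : ∀ n → ∃ λ a → (a # 0#) × Lead n a (_^ suc n)
    Lead-^ zero = 1# , 1#0 , λ x w →
      solve 2 (λ x w → (x :+ w) :* con 1 := con 1 :* w :+ x :* con 1) refl x w
    Lead-^ (suc n) with Lead-^ n
    ... | a , a#0 , lead = suc (suc n) ×′ a ,
      #-congʳ (trans (×-assoc-* (suc (suc n)) 1# a) (×-congʳ (suc (suc n)) (*-identityˡ a)))
        (x#0y#0→xy#0 (char0 (suc (suc n))) a#0) ,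
      Lead-x* n lead

    -- At most one of the shifts of w can vanish, hence none in one of the two
    -- disjoint blocks; cotransitivity of # tells which block.
    shift-dichotomy : ∀ m w →
      (∀ (i : Fin m) → (suc (toℕ i) ×′ 1# + w) # 0#) ⊎
      (∀ (i : Fin m) → (suc (m ℕ.+ toℕ i) ×′ 1# + w) # 0#)
    shift-dichotomy m w =
      -- For each `i`, either its shift is apart from zero or the whole second block is. The latter
      -- answer for any `i` ends the search; otherwise the first block succeeds.
      swap (Fin.sequence (Left.applicative _ ℓ₂) λ i →
        swap (Fin.sequence (Left.applicative _ ℓ₂) λ j → apart i j))
      where
      apart : ∀ (i j : Fin m) →
        ((suc (toℕ i) ×′ 1# + w) # 0#) ⊎ ((suc (m ℕ.+ toℕ j) ×′ 1# + w) # 0#)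
      apart i j with #-cotrans (<⇒×1#×1 {suc (toℕ i)} {suc (m ℕ.+ toℕ j)}
                       (s≤s (ℕ.≤-trans (Fin.toℕ<n i) (ℕ.m≤m+n m (toℕ j))))) (- w)
      ... | inj₁ q = inj₂ (#-congʳ (+-congˡ (-‿involutive w)) (#⇒-#0 q))
      ... | inj₂ q = inj₁ (#-congʳ (+-congˡ (-‿involutive w)) (#⇒-#0 (#-sym q)))

    -- `P k c` is to be read as: `c` has a signed representation of length `k`.
    module Waring {ℓ} (P : ℕ → Carrier → Set ℓ)
      (P-resp : ∀ {k a b} → a ≈ b → P k a → P k b)
      (P-minus : ∀ {j k a b} → P j a → P k b → P (j ℕ.+ k) (a - b)) where

      -- Powers are available at invertible arguments only, so values of their iterated differences
      -- are available only where `m` consecutive shifts of `x` are apart from zero.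
      Good : ℕ → ℕ → (Carrier → Carrier) → Set _
      Good m k p = ∀ x → (∀ (i : Fin m) → (toℕ i ×′ 1# + x) # 0#) → P k (p x)

      Good-Δ : ∀ {m k p q} → (∀ x → p (x + 1#) ≈ q x + p x) →
               Good m k p → Good (suc m) (k ℕ.+ k) q
      Good-Δ Δp good x x+i#0 = P-resp (x-y≈z (Δp x)) (P-minus
        (good (x + 1#) λ i → #-congʳ
          (solve 2 (λ n x → (con 1 :+ n) :+ x := n :+ (x :+ con 1)) refl (toℕ i ×′ 1#) x)
          (x+i#0 (Fin.suc i)))
        (good x λ i → #-congʳ
          (+-congʳ (×-congˡ (Fin.toℕ-inject₁ i))) (x+i#0 (inject₁ i))))

      -- Each difference doubles the length and adds one shift. Once `p` is affine with invertible
      -- slope `a`, its increments `a * w` take every value.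
      represent : ∀ n {a m k p} → a # 0# → Lead n a p → Good m k p →
                  ∃ λ N → ∀ c → P N c
      represent (suc n) a#0 (q , Δp , q-lead) good =
        represent n a#0 q-lead (Good-Δ Δp good)
      represent zero {a} {m} {k} {p} a#0 p-lin good = k ℕ.+ k , difference
        where
        difference : ∀ c → P (k ℕ.+ k) c
        difference c = from (shift-dichotomy m w)
          where
          w = inv (a , a#0) * c

          aw≈c : a * w ≈ c
          aw≈c = begin
            a * w                     ≈⟨ *-assoc a (inv (a , a#0)) c ⟨
            (a * inv (a , a#0)) * c   ≈⟨ *-congʳ (inv-inverseʳ (a , a#0)) ⟩
            1# * c                    ≈⟨ *-identityˡ c ⟩
            c                         ∎

          add : ∀ i j → suc (j ℕ.+ i) ×′ 1# ≈ i ×′ 1# + suc j ×′ 1#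
          add i j = trans (+-congˡ (×-homo-+ 1# j i))
            (solve 2 (λ i j → con 1 :+ (j :+ i) := i :+ (con 1 :+ j)) refl
              (i ×′ 1#) (j ×′ 1#))

          -- Writes `c` as `p (v + w) - p v`. The shifts of `v` are positive integers, covered by
          -- characteristic zero; those of `v + w` are covered by the hypothesis.
          at : ∀ j → (∀ (i : Fin m) → (suc (j ℕ.+ toℕ i) ×′ 1# + w) # 0#) →
               P (k ℕ.+ k) c
          at j v+w+i#0 = P-resp (trans (x-y≈z (p-lin v w)) aw≈c) (P-minus
            (good (v + w) λ i → #-congʳ
              (trans (+-congʳ (add (toℕ i) j)) (+-assoc _ v w)) (v+w+i#0 i))
            (good v λ i → #-congʳ (add (toℕ i) j) (char0 (suc (j ℕ.+ toℕ i)))))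
            where v = suc j ×′ 1#

          from : _ → P (k ℕ.+ k) c
          from (inj₁ v+w+i#0) = at 0 v+w+i#0
          from (inj₂ v+w+i#0) = at m v+w+i#0

      powers⇒all : ∀ n {k} → (∀ y → y # 0# → P k (y ^ suc n)) →
                   ∃ λ N → ∀ c → P N c
      powers⇒all n powers with Lead-^ n
      ... | a , a#0 , lead = represent n {m = 1} a#0 lead
        (λ x x#0 → powers x (#-congʳ (+-identityˡ x) (x#0 Fin.zero)))

    -- Separating the exponents

    module _ (S : List ℤ) where

      -- All X k vanish at the exponent 0, so the product over t of the functions
      -- γ β - N needs a starting factor that vanishes there.
      isolate : ∀ {s} → s ≢ 0ℤ → ∀ L →
        ∃₂ λ k E → T S k E × (E s # 0#) × (∀ {u} → u ∈ L → u ≢ s → E u ≈ 0#)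
      isolate {s} s≢0 [] with separate 0ℤ
      ... | β , N , β⁰≈N , β^s-N#0 =
        -- At the exponent 0 the constant `N` is 1, and the constant function 1 is γ 1.
        1 , (λ u → β ^ᶻ u - one* ^ᶻ u) , T-γ-γ S β one* ,
        #-congʳ (+-congˡ (-‿cong (trans (sym β⁰≈N) (sym (one*^ᶻ s))))) (β^s-N#0 s s≢0) ,
        λ ()
      isolate {s} s≢0 (t ∷ L) with isolate s≢0 L | t ℤ.≟ s
      ... | k , E , E∈T , Es#0 , E≈0 | yes ≡.refl = k , E , E∈T , Es#0 , λ where
        (here u≡s)  u≢s → contradiction u≡s u≢s
        (there u∈L) u≢s → E≈0 u∈L u≢s
      ... | k , E , E∈T , Es#0 , E≈0 | no t≢s with separate t
      ... | β , N , β^t≈N , β^s-N#0 =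
        -- Multiplication by `N` is possible since it is a natural number: `N` copies of `E` are
        -- subtracted.
        k ℕ.+ N ℕ.* k , (λ u → β ^ᶻ u * E u - N ×′ E u) ,
        T-minus S (T-γ* S β E∈T) (T-× S N E∈T) ,
        #-congʳ (factor s) (x#0y#0→xy#0 (β^s-N#0 s (t≢s ∘ ≡.sym)) Es#0) ,
        λ where
          (here ≡.refl) _   → trans (sym (factor t))
            (trans (*-congʳ (x≈y⇒x∙y⁻¹≈ε β^t≈N)) (zeroˡ (E t)))
          {u} (there u∈L) u≢s → trans (sym (factor u))
            (trans (*-congˡ (E≈0 u∈L u≢s)) (zeroʳ _))
        where
        factor : ∀ u → (β ^ᶻ u - N ×′ 1#) * E u ≈ β ^ᶻ u * E u - N ×′ E u
        factor u = trans ([y-z]x≈yx-zx (E u) (β ^ᶻ u) (N ×′ 1#))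
          (+-congˡ (-‿cong (trans (×-assoc-* N 1# (E u)) (×-congʳ N (*-identityˡ (E u))))))

      -- For negative `s` the inverse of `y` serves as `x`; `suc n` is the absolute value of `s`.
      powers-are-^ᶻ : ∀ {s} → s ≢ 0ℤ →
        ∃ λ n → ∀ y → y # 0# → ∃ λ x → x ^ᶻ s ≈ y ^ suc n
      powers-are-^ᶻ {+ zero}  s≢0 = contradiction ≡.refl s≢0
      powers-are-^ᶻ {+ suc n} s≢0 = n , λ y y#0 → (y , y#0) , refl
      powers-are-^ᶻ { -[1+ n ]} s≢0 = n , λ y y#0 →
        inv* (y , y#0) , ^-congˡ (suc n) (inv-inv* (y , y#0))

      δ∈T : ∀ {s} → s ≢ 0ℤ → ∃ λ k → ∀ a → T S k (δ S s a)
      δ∈T {s} s≢0 with isolate s≢0 S | powers-are-^ᶻ s≢0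
      ... | k , E , E∈T , Es#0 , E≈0 | n , powers =
        proj₁ all , λ a → T-resp S (λ {u} _ → δ-cong u (rescale a))
          (proj₂ all (a * inv (E s , Es#0)))
        where
        δ-cong : ∀ {a b} u → a ≈ b → δ S s a u ≈ δ S s b u
        δ-cong u a≈b with u ℤ.≟ s
        ... | yes _ = a≈b
        ... | no _  = refl

        δ-minus : ∀ a b {u} → u ∈ S →
          δ S s (a * E s) u - δ S s (b * E s) u ≈ δ S s ((a - b) * E s) u
        δ-minus a b = δ-unique S
          {h = λ u → δ S s (a * E s) u - δ S s (b * E s) u}
          (trans (+-cong (δ-diag S s _) (-‿cong (δ-diag S s _))) (sym ([y-z]x≈yx-zx (E s) a b)))
          (λ _ u≢s → trans (+-cong (δ-off S _ u≢s) (-‿cong (δ-off S _ u≢s))) (-‿inverseʳ 0#))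

        -- Coefficients are measured in units of `E s`, so that x^s `E` stands for the power
        -- `y ^ suc n`; `rescale` removes the unit at the end.
        open Waring (λ k a → T S k (δ S s (a * E s)))
          (λ a≈b → T-resp S (λ {u} _ → δ-cong u (*-congʳ a≈b)))
          (λ {j} {l} {a} {b} a∈ b∈ → T-resp S (δ-minus a b) (T-minus S a∈ b∈))

        all : ∃ λ N → ∀ a → T S N (δ S s (a * E s))
        all = powers⇒all n {k} (λ y y#0 → T-resp S
          (δ-unique S {h = λ u → proj₁ (powers y y#0) ^ᶻ u * E u}
            (*-congʳ (proj₂ (powers y y#0)))
            (λ u∈S u≢s → trans (*-congˡ (E≈0 u∈S u≢s)) (zeroʳ _)))
          (T-γ* S (proj₁ (powers y y#0)) E∈T))

        rescale : ∀ a → (a * inv (E s , Es#0)) * E s ≈ a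
        rescale a = begin
          (a * inv (E s , Es#0)) * E s  ≈⟨ *-assoc _ _ _ ⟩
          a * (inv (E s , Es#0) * E s)  ≈⟨ *-congˡ (*-comm _ _) ⟩
          a * (E s * inv (E s , Es#0))  ≈⟨ *-congˡ (inv-inverseʳ (E s , Es#0)) ⟩
          a * 1#                        ≈⟨ *-identityʳ a ⟩
          a                             ∎

theorem3p2 : ∀ {c ℓ₁ ℓ₂} (K : HeytingField c ℓ₁ ℓ₂) → CharacteristicZero K →
    (S : List ℤ) → Unique S → All (_≢ 0ℤ) S →
    ∃ λ (N : ℕ) → (N > 0) × (X K S N ≐ U)
theorem3p2 K char0 S S! S≢0 =
  suc (proj₁ interp) , s≤s z≤n , (λ _ → _) , λ {f} _ → T-extend⇒X K S S!
    (let h , h∈T , h≈f = proj₂ interp (extend K S f)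
     in T-pad K S (T-resp K S h≈f h∈T))
  where
  interp = interpolate K S (All.map (δ∈T K char0 S) S≢0)
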